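{- Let $a,b,c$ be nonzero real numbers, let $w_0,w_1$ be arbitrary real initial values, let $\{w_n\}$ be the associated generalized bi-periodic Horadam sequence and $\{u_n\}$ the generalized bi-periodic Fibonacci sequence. Then for any positive integers $n,p,q$, $$\left(\frac ba\right)^{\zeta(n)\zeta(p)\zeta(q)}w_{n+p}w_{n+q}-\left(\frac ba\right)^{\zeta(n+1)\zeta(p)\zeta(q)}w_n w_{n+p+q}$$ $$=\left(\frac ba\right)^{\zeta(n)\zeta(p+1)\zeta(q+1)}(-c)^n u_p u_q\left(w_1^2-b\,w_0w_1-\frac ba\,c\,w_0^2\right).$$
   Context: For nonzero real numbers $a,b,c$ and real initial values $w_0,w_1$, the generalized bi-periodic Horadam sequence $\{w_n\}$ is defined by $w_n=\chi(n)w_{n-1}+c\,w_{n-2}$ for $n\ge 2$, where $\chi(n)=a$ if $n$ is even and $\chi(n)=b$ if $n$ is odd. The generalized bi-periodic Fibonacci sequence $\{u_n\}$ satisfies the same recurrence (same $a,b,c$) with $u_0=0$, $u_1=1$. The parity function is $\zeta(n)=0$ if $n$ is even and $\zeta(n)=1$ if $n$ is odd. -}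

module Defs where

open import Algebra.Bundles using (CommutativeRing)
import Algebra.Properties.Semiring.Exp as Exp
open import Data.Nat.Base as ℕ using (ℕ; zero; suc; parity)
import Data.Nat.Properties as ℕ
open import Data.Parity.Base using (0ℙ; 1ℙ)
open import Data.Product.Base using (∃-syntax; _×_; _,_)
open import Data.Rational.Base as ℚ using (ℚ; 0ℚ; 1ℚ; ½; ∣_∣; 1/_)
import Data.Rational.Properties as ℚ
open import Data.Rational.Solver using (module +-*-Solver)
open import Level using (0ℓ)
open import Relation.Binary.PropositionalEquality using (_≡_; _≢_; refl; sym; trans; cong; cong₂; subst)
open import Relation.Binary.Structures using (IsEquivalence)
open import Relation.Nullary using (¬_; yes; no; contradiction)

-- f ~ g says that f m - g n tends to 0 as m and n tend to infinity
-- independently.  In particular f ~ f says that f is a Cauchy sequence, and on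
-- Cauchy sequences _~_ is the usual equivalence f n - g n → 0.

infix 4 _~_

record _~_ (f g : ℕ → ℚ) : Set where
  constructor mk~
  field
    close : ∀ ε → 0ℚ ℚ.< ε → ∃[ N ] ∀ m n → N ℕ.≤ m → N ℕ.≤ n → ∣ f m ℚ.- g n ∣ ℚ.< ε

open _~_ public

private

  open +-*-Solver using (solve; _:+_; _:*_; :-_; _:-_; _:=_; con)

  ½-pos : ∀ {ε} → 0ℚ ℚ.< ε → 0ℚ ℚ.< ½ ℚ.* ε
  ½-pos {ε} 0<ε = subst (ℚ._< ½ ℚ.* ε) (ℚ.*-zeroʳ ½) (ℚ.*-monoʳ-<-pos ½ 0<ε)

  *-pos : ∀ {p q} → 0ℚ ℚ.< p → 0ℚ ℚ.< q → 0ℚ ℚ.< p ℚ.* q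
  *-pos {p} {q} 0<p 0<q =
    subst (ℚ._< p ℚ.* q) (ℚ.*-zeroʳ p) (ℚ.*-monoʳ-<-pos p {{ℚ.positive 0<p}} 0<q)

  halves : ∀ ε → ½ ℚ.* ε ℚ.+ ½ ℚ.* ε ≡ ε
  halves = solve 1 (λ e → con ½ :* e :+ con ½ :* e := e) refl

  triangle : ∀ {ε} x y → ∣ x ∣ ℚ.< ½ ℚ.* ε → ∣ y ∣ ℚ.< ½ ℚ.* ε → ∣ x ℚ.+ y ∣ ℚ.< ε
  triangle {ε} x y p q = ℚ.≤-<-trans (ℚ.∣p+q∣≤∣p∣+∣q∣ x y)
    (subst (∣ x ∣ ℚ.+ ∣ y ∣ ℚ.<_) (halves ε) (ℚ.+-mono-< p q))

  swap : ∀ p q → ∣ p ℚ.- q ∣ ≡ ∣ q ℚ.- p ∣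
  swap p q = trans (sym (ℚ.∣-p∣≡∣p∣ (p ℚ.- q)))
    (cong ∣_∣ (solve 2 (λ p q → :- (p :- q) := q :- p) refl p q))

  ⊔ˡ : ∀ {k} m n → m ℕ.⊔ n ℕ.≤ k → m ℕ.≤ k
  ⊔ˡ m n = ℕ.≤-trans (ℕ.m≤m⊔n m n)

  ⊔ʳ : ∀ {k} m n → m ℕ.⊔ n ℕ.≤ k → n ℕ.≤ k
  ⊔ʳ m n = ℕ.≤-trans (ℕ.m≤n⊔m m n)

~-sym : ∀ {f g} → f ~ g → g ~ f
~-sym {f} {g} f~g .close ε 0<ε with close f~g ε 0<ε
... | N , h = N , λ m n N≤m N≤n → subst (ℚ._< ε) (swap (f n) (g m)) (h n m N≤n N≤m)

~-trans : ∀ {f g h} → f ~ g → g ~ h → f ~ h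
~-trans {f} {g} {h} f~g g~h .close ε 0<ε with close f~g (½ ℚ.* ε) (½-pos 0<ε) | close g~h (½ ℚ.* ε) (½-pos 0<ε)
... | M , p | N , q = K , λ m n K≤m K≤n →
  subst (λ x → ∣ x ∣ ℚ.< ε)
    (solve 3 (λ x y z → (x :- y) :+ (y :- z) := x :- z) refl (f m) (g K) (h n))
    (triangle (f m ℚ.- g K) (g K ℚ.- h n)
      (p m K (⊔ˡ M N K≤m) (ℕ.m≤m⊔n M N))
      (q K n (ℕ.m≤n⊔m M N) (⊔ʳ M N K≤n)))
  where K = M ℕ.⊔ N

~-reflexive : ∀ {f g} → f ~ f → (∀ n → f n ≡ g n) → f ~ g
~-reflexive {f} {g} f~f f≡g .close ε 0<ε with close f~f ε 0<ε
... | N , h = N , λ m n N≤m N≤n →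
  subst (λ x → ∣ f m ℚ.- x ∣ ℚ.< ε) (f≡g n) (h m n N≤m N≤n)

~-const : ∀ p → (λ _ → p) ~ (λ _ → p)
~-const p .close ε 0<ε = 0 , λ _ _ _ _ →
  subst (λ x → ∣ x ∣ ℚ.< ε) (sym (ℚ.+-inverseʳ p)) 0<ε

~-neg : ∀ {f g} → f ~ g → (λ n → ℚ.- f n) ~ (λ n → ℚ.- g n)
~-neg {f} {g} f~g .close ε 0<ε with close f~g ε 0<ε
... | N , h = N , λ m n N≤m N≤n →
  subst (ℚ._< ε)
    (trans (swap (f m) (g n))
      (cong ∣_∣ (solve 2 (λ x y → y :- x := (:- x) :- (:- y)) refl (f m) (g n))))
    (h m n N≤m N≤n)

~-+ : ∀ {f f′ g g′} → f ~ f′ → g ~ g′ → (λ n → f n ℚ.+ g n) ~ (λ n → f′ n ℚ.+ g′ n)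
~-+ {f} {f′} {g} {g′} f~f′ g~g′ .close ε 0<ε with close f~f′ (½ ℚ.* ε) (½-pos 0<ε) | close g~g′ (½ ℚ.* ε) (½-pos 0<ε)
... | M , p | N , q = M ℕ.⊔ N , λ m n K≤m K≤n →
  subst (λ x → ∣ x ∣ ℚ.< ε)
    (solve 4 (λ a b c d → (a :- b) :+ (c :- d) := (a :+ c) :- (b :+ d)) refl (f m) (f′ n) (g m) (g′ n))
    (triangle (f m ℚ.- f′ n) (g m ℚ.- g′ n)
      (p m n (⊔ˡ M N K≤m) (⊔ˡ M N K≤n))
      (q m n (⊔ʳ M N K≤m) (⊔ʳ M N K≤n)))

private

  *-difference : ∀ a b c d → a ℚ.* (c ℚ.- d) ℚ.+ d ℚ.* (a ℚ.- b) ≡ a ℚ.* c ℚ.- b ℚ.* d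
  *-difference = solve 4 (λ a b c d → a :* (c :- d) :+ d :* (a :- b) := a :* c :- b :* d) refl

  cross-difference : ∀ p q r s → (r ℚ.- s) ℚ.* (p ℚ.* q) ≡ q ℚ.* (p ℚ.* r) ℚ.- p ℚ.* (q ℚ.* s)
  cross-difference = solve 4 (λ p q r s → (r :- s) :* (p :* q) := q :* (p :* r) :- p :* (q :* s)) refl

  bounded : ∀ {f g} → f ~ g → ∃[ B ] 0ℚ ℚ.< B × ∃[ N ] ∀ m → N ℕ.≤ m → ∣ f m ∣ ℚ.≤ B
  bounded {f} {g} f~g with close f~g 1ℚ (ℚ.positive⁻¹ 1ℚ)
  ... | N , h = 1ℚ ℚ.+ ∣ g N ∣ , ℚ.+-mono-<-≤ (ℚ.positive⁻¹ 1ℚ) (ℚ.0≤∣p∣ (g N)) , N , λ m N≤m →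
    subst (λ x → ∣ x ∣ ℚ.≤ 1ℚ ℚ.+ ∣ g N ∣)
      (solve 2 (λ x y → (x :- y) :+ y := x) refl (f m) (g N))
      (ℚ.≤-trans (ℚ.∣p+q∣≤∣p∣+∣q∣ (f m ℚ.- g N) (g N))
        (ℚ.+-monoˡ-≤ ∣ g N ∣ (ℚ.<⇒≤ (h m N N≤m ℕ.≤-refl))))

  shrink : ∀ B ε → 0ℚ ℚ.< B → 0ℚ ℚ.< ε → ∃[ δ ] 0ℚ ℚ.< δ × B ℚ.* δ ≡ ε
  shrink B ε 0<B 0<ε = 1/ B ℚ.* ε , *-pos (ℚ.positive⁻¹ (1/ B) {{ℚ.1/pos⇒pos B}}) 0<ε ,
    trans (sym (ℚ.*-assoc B (1/ B) ε)) (trans (cong (ℚ._* ε) (ℚ.*-inverseʳ B)) (ℚ.*-identityˡ ε))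
    where
    instance
      B>0 : ℚ.Positive B
      B>0 = ℚ.positive 0<B
      B≢0 : ℚ.NonZero B
      B≢0 = ℚ.pos⇒nonZero B

  *-bound : ∀ {B δ ε} x y → 0ℚ ℚ.< B → B ℚ.* δ ≡ ε → ∣ x ∣ ℚ.≤ B → ∣ y ∣ ℚ.< δ → ∣ x ℚ.* y ∣ ℚ.< ε
  *-bound {B} {δ} x y 0<B refl x≤B y<δ = subst (ℚ._< B ℚ.* δ) (sym (ℚ.∣p*q∣≡∣p∣*∣q∣ x y))
    (ℚ.≤-<-trans (ℚ.*-monoʳ-≤-nonNeg ∣ y ∣ {{ℚ.∣-∣-nonNeg y}} x≤B)
      (ℚ.*-monoʳ-<-pos B {{ℚ.positive 0<B}} y<δ))

~-* : ∀ {f f′ g g′} → f ~ f′ → g ~ g′ → (λ n → f n ℚ.* g n) ~ (λ n → f′ n ℚ.* g′ n)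
~-* {f} {f′} {g} {g′} f~f′ g~g′ .close ε 0<ε =
  let B , 0<B , K , f≤B  = bounded f~f′
      C , 0<C , L , g′≤C = bounded (~-sym g~g′)
      β , 0<β , Bβ = shrink B (½ ℚ.* ε) 0<B (½-pos 0<ε)
      γ , 0<γ , Cγ = shrink C (½ ℚ.* ε) 0<C (½-pos 0<ε)
      M , p = close g~g′ β 0<β
      N , q = close f~f′ γ 0<γ
  in (K ℕ.⊔ L) ℕ.⊔ (M ℕ.⊔ N) , λ m n J≤m J≤n →
    let KL≤m = ⊔ˡ (K ℕ.⊔ L) (M ℕ.⊔ N) J≤m
        KL≤n = ⊔ˡ (K ℕ.⊔ L) (M ℕ.⊔ N) J≤n
        MN≤m = ⊔ʳ (K ℕ.⊔ L) (M ℕ.⊔ N) J≤m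
        MN≤n = ⊔ʳ (K ℕ.⊔ L) (M ℕ.⊔ N) J≤n
        f[g-g′]<½ε = *-bound (f m) (g m ℚ.- g′ n) 0<B Bβ
          (f≤B m (⊔ˡ K L KL≤m)) (p m n (⊔ˡ M N MN≤m) (⊔ˡ M N MN≤n))
        g′[f-f′]<½ε = *-bound (g′ n) (f m ℚ.- f′ n) 0<C Cγ
          (g′≤C n (⊔ʳ K L KL≤n)) (q m n (⊔ʳ M N MN≤m) (⊔ʳ M N MN≤n))
    in subst (λ x → ∣ x ∣ ℚ.< ε) (*-difference (f m) (f′ n) (g m) (g′ n))
      (triangle (f m ℚ.* (g m ℚ.- g′ n)) (g′ n ℚ.* (f m ℚ.- f′ n)) f[g-g′]<½ε g′[f-f′]<½ε)

record ℝ : Set where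
  constructor mkℝ
  field
    seq    : ℕ → ℚ
    cauchy : seq ~ seq

open ℝ public

infix 4 _≈_ _#_
infixl 7 _*_
infixl 6 _+_
infix 8 -_

record _≈_ (x y : ℝ) : Set where
  constructor mk≈
  field
    seq~ : seq x ~ seq y

open _≈_ public

0ℝ 1ℝ : ℝ
0ℝ = mkℝ (λ _ → 0ℚ) (~-const 0ℚ)
1ℝ = mkℝ (λ _ → 1ℚ) (~-const 1ℚ)

_+_ _*_ : ℝ → ℝ → ℝ
x + y = mkℝ (λ n → seq x n ℚ.+ seq y n) (~-+ (cauchy x) (cauchy y))
x * y = mkℝ (λ n → seq x n ℚ.* seq y n) (~-* (cauchy x) (cauchy y))

-_ : ℝ → ℝ
- x = mkℝ (λ n → ℚ.- seq x n) (~-neg (cauchy x))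

private

  pointwise : ∀ {x y} → (∀ n → seq x n ≡ seq y n) → x ≈ y
  pointwise {x} x≡y = mk≈ (~-reflexive (cauchy x) x≡y)

≈-isEquivalence : IsEquivalence _≈_
≈-isEquivalence = record
  { refl  = λ {x} → mk≈ (cauchy x)
  ; sym   = λ x≈y → mk≈ (~-sym (seq~ x≈y))
  ; trans = λ x≈y y≈z → mk≈ (~-trans (seq~ x≈y) (seq~ y≈z))
  }

ℝ-commutativeRing : CommutativeRing 0ℓ 0ℓ
ℝ-commutativeRing = record
  { Carrier = ℝ
  ; _≈_ = _≈_
  ; _+_ = _+_
  ; _*_ = _*_
  ; -_ = -_
  ; 0# = 0ℝ
  ; 1# = 1ℝ
  ; isCommutativeRing = record
    { isRing = record
      { +-isAbelianGroup = record
        { isGroup = record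
          { isMonoid = record
            { isSemigroup = record
              { isMagma = record
                { isEquivalence = ≈-isEquivalence
                ; ∙-cong = λ p q → mk≈ (~-+ (seq~ p) (seq~ q))
                }
              ; assoc = λ x y z → pointwise λ n → ℚ.+-assoc (seq x n) (seq y n) (seq z n)
              }
            ; identity = (λ x → pointwise λ n → ℚ.+-identityˡ (seq x n))
                       , (λ x → pointwise λ n → ℚ.+-identityʳ (seq x n))
            }
          ; inverse = (λ x → pointwise λ n → ℚ.+-inverseˡ (seq x n))
                    , (λ x → pointwise λ n → ℚ.+-inverseʳ (seq x n))
          ; ⁻¹-cong = λ p → mk≈ (~-neg (seq~ p))
          }
        ; comm = λ x y → pointwise λ n → ℚ.+-comm (seq x n) (seq y n)
        }
      ; *-cong = λ p q → mk≈ (~-* (seq~ p) (seq~ q))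
      ; *-assoc = λ x y z → pointwise λ n → ℚ.*-assoc (seq x n) (seq y n) (seq z n)
      ; *-identity = (λ x → pointwise λ n → ℚ.*-identityˡ (seq x n))
                   , (λ x → pointwise λ n → ℚ.*-identityʳ (seq x n))
      ; distrib = (λ x y z → pointwise λ n → ℚ.*-distribˡ-+ (seq x n) (seq y n) (seq z n))
                , (λ x y z → pointwise λ n → ℚ.*-distribʳ-+ (seq x n) (seq y n) (seq z n))
      }
    ; *-comm = λ x y → pointwise λ n → ℚ.*-comm (seq x n) (seq y n)
    }
  }

open CommutativeRing ℝ-commutativeRing public using (_-_)
open Exp (CommutativeRing.semiring ℝ-commutativeRing) public using (_^_)

-- The constructive form of x ≠ y: the distance of x and y has a positive lower
-- bound.  Classically it is equivalent to ¬ (x ≈ y).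
record _#_ (x y : ℝ) : Set where
  constructor mk#
  field
    apart : ∃[ ε ] 0ℚ ℚ.< ε × ∃[ N ] ∀ n → N ℕ.≤ n → ε ℚ.≤ ∣ seq x n ℚ.- seq y n ∣

open _#_ public

#⇒≉ : ∀ {x y} → x # y → ¬ (x ≈ y)
#⇒≉ (mk# (ε , 0<ε , M , far)) (mk≈ x~y) with close x~y ε 0<ε
... | N , near = ℚ.<-irrefl refl (ℚ.<-≤-trans (near K K N≤K N≤K) (far K (ℕ.m≤m⊔n M N)))
  where
  K = M ℕ.⊔ N
  N≤K = ℕ.m≤n⊔m M N

private

  recip : ℚ → ℚ
  recip p with p ℚ.≟ 0ℚ
  ... | yes _   = 0ℚ
  ... | no  p≢0 = (1/ p) {{ℚ.≢-nonZero p≢0}}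

  recip-inverseʳ : ∀ p → p ≢ 0ℚ → p ℚ.* recip p ≡ 1ℚ
  recip-inverseʳ p p≢0 with p ℚ.≟ 0ℚ
  ... | yes p≡0 = contradiction p≡0 p≢0
  ... | no  p≢0 = ℚ.*-inverseʳ p {{ℚ.≢-nonZero p≢0}}

  Away : ℚ → ℚ → Set
  Away ε p = ε ℚ.≤ ∣ p ∣

  away⇒≢0 : ∀ {ε} p → 0ℚ ℚ.< ε → Away ε p → p ≢ 0ℚ
  away⇒≢0 p 0<ε ε≤∣p∣ refl = ℚ.<-irrefl refl (ℚ.<-≤-trans 0<ε ε≤∣p∣)

  recip-close : ∀ {ε δ} p q → 0ℚ ℚ.< ε → Away ε p → Away ε q →
                ∣ p ℚ.- q ∣ ℚ.< δ ℚ.* (ε ℚ.* ε) → ∣ recip p ℚ.- recip q ∣ ℚ.< δ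
  recip-close {ε} {δ} p q 0<ε ε≤p ε≤q p-q<δε² =
    ℚ.*-cancelʳ-<-nonNeg (ε ℚ.* ε) {{ε²≥0}} (ℚ.≤-<-trans ≤∣p-q∣ p-q<δε²)
    where
    instance
      ε≥0 : ℚ.NonNegative ε
      ε≥0 = ℚ.nonNegative (ℚ.<⇒≤ 0<ε)
      ε²≥0 : ℚ.NonNegative (ε ℚ.* ε)
      ε²≥0 = ℚ.nonNegative (ℚ.<⇒≤ (*-pos 0<ε 0<ε))
    r = recip p
    s = recip q
    rearrange : (r ℚ.- s) ℚ.* (p ℚ.* q) ≡ q ℚ.- p
    rearrange = trans
      (cross-difference p q r s)
      (cong₂ ℚ._-_
        (trans (cong (q ℚ.*_) (recip-inverseʳ p (away⇒≢0 p 0<ε ε≤p))) (ℚ.*-identityʳ q))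
        (trans (cong (p ℚ.*_) (recip-inverseʳ q (away⇒≢0 q 0<ε ε≤q))) (ℚ.*-identityʳ p)))
    ε²≤∣pq∣ : ε ℚ.* ε ℚ.≤ ∣ p ℚ.* q ∣
    ε²≤∣pq∣ = subst (ε ℚ.* ε ℚ.≤_) (sym (ℚ.∣p*q∣≡∣p∣*∣q∣ p q))
      (ℚ.≤-trans (ℚ.*-monoʳ-≤-nonNeg ε ε≤p) (ℚ.*-monoˡ-≤-nonNeg ∣ p ∣ {{ℚ.∣-∣-nonNeg p}} ε≤q))
    ≤∣p-q∣ : ∣ r ℚ.- s ∣ ℚ.* (ε ℚ.* ε) ℚ.≤ ∣ p ℚ.- q ∣
    ≤∣p-q∣ = subst (∣ r ℚ.- s ∣ ℚ.* (ε ℚ.* ε) ℚ.≤_)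
      (trans (sym (ℚ.∣p*q∣≡∣p∣*∣q∣ (r ℚ.- s) (p ℚ.* q))) (trans (cong ∣_∣ rearrange) (swap q p)))
      (ℚ.*-monoˡ-≤-nonNeg ∣ r ℚ.- s ∣ {{ℚ.∣-∣-nonNeg (r ℚ.- s)}} ε²≤∣pq∣)

  away : ∀ {x} → x # 0ℝ → ∃[ ε ] 0ℚ ℚ.< ε × ∃[ N ] ∀ n → N ℕ.≤ n → Away ε (seq x n)
  away {x} (mk# (ε , 0<ε , N , far)) = ε , 0<ε , N , λ n N≤n →
    subst (Away ε) (ℚ.+-identityʳ (seq x n)) (far n N≤n)

  recip-cauchy : ∀ x → x # 0ℝ → (λ n → recip (seq x n)) ~ (λ n → recip (seq x n))
  recip-cauchy x x#0 .close δ 0<δ with away x#0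
  ... | ε , 0<ε , M , far with close (cauchy x) (δ ℚ.* (ε ℚ.* ε)) (*-pos 0<δ (*-pos 0<ε 0<ε))
  ... | N , near = M ℕ.⊔ N , λ m n K≤m K≤n →
    recip-close (seq x m) (seq x n) 0<ε (far m (⊔ˡ M N K≤m)) (far n (⊔ˡ M N K≤n))
      (near m n (⊔ʳ M N K≤m) (⊔ʳ M N K≤n))

infix 8 _⁻¹
infixl 7 _/_

_⁻¹ : (x : ℝ) {{x#0 : x # 0ℝ}} → ℝ
_⁻¹ x {{x#0}} = mkℝ (λ n → recip (seq x n)) (recip-cauchy x x#0)

_/_ : (x y : ℝ) {{y#0 : y # 0ℝ}} → ℝ
x / y = x * y ⁻¹

*-inverseʳ : ∀ x {{x#0 : x # 0ℝ}} → x * x ⁻¹ ≈ 1ℝ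
*-inverseʳ x {{x#0}} = mk≈ eventually
  where
  eventually : seq (x * x ⁻¹) ~ seq 1ℝ
  eventually .close δ 0<δ with away x#0
  ... | ε , 0<ε , N , far = N , λ m n N≤m _ →
    subst (λ p → ∣ p ℚ.- 1ℚ ∣ ℚ.< δ)
      (sym (recip-inverseʳ (seq x m) (away⇒≢0 (seq x m) 0<ε (far m N≤m)))) 0<δ

ζ : ℕ → ℕ
ζ n with parity n
... | 0ℙ = 0
... | 1ℙ = 1

χ : (a b : ℝ) → ℕ → ℝ
χ a b n with parity n
... | 0ℙ = a
... | 1ℙ = b

horadam : (a b c w₀ w₁ : ℝ) → ℕ → ℝ
horadam a b c w₀ w₁ 0             = w₀
horadam a b c w₀ w₁ 1             = w₁
horadam a b c w₀ w₁ (suc (suc n)) =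
  χ a b (suc (suc n)) * horadam a b c w₀ w₁ (suc n) + c * horadam a b c w₀ w₁ n

fibonacci : (a b c : ℝ) → ℕ → ℝ
fibonacci a b c = horadam a b c 0ℝ 1ℝ

{-# OPTIONS --safe #-}
module Submission where

-- Let D(n, p, q) be the left-hand side and r = b/a.  For fixed n and p it
-- satisfies in q the Horadam recurrence, with a and b exchanged when n is odd
-- and p is even: the powers of r absorb every other mismatch of parities,
-- because r a = b.  The same holds for r^(ζ(n)ζ(p+1)ζ(q+1)) u_q, and
-- D(n, p, 0) = 0, so D(n, p, q) = r^(ζ(n)ζ(p+1)ζ(q+1)) u_q D(n, p, 1).  By
-- symmetry in p and q, D(n, p, 1) = D(n, 1, p) = u_p D(n, 1, 1).  Finally
-- D(n+1, 1, 1) = -c D(n, 1, 1), as in Cassini's identity.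

open import Algebra.Bundles using (CommutativeRing)
import Algebra.Properties.Ring as RingProperties
import Algebra.Properties.Semiring.Exp as Exp
import Algebra.Solver.Ring.NaturalCoefficients.Default as SemiringSolver
open import Data.Nat.Base as ℕ using (ℕ; suc; NonZero; parity)
import Data.Nat.Properties as ℕ
open import Data.Parity.Base as ℙ using (Parity; 0ℙ; 1ℙ)
import Data.Parity.Properties as ℙ
import Relation.Binary.Reasoning.Setoid as SetoidReasoning
open import Relation.Binary.PropositionalEquality as ≡ using (_≡_)
open import Defs using (ζ)

-- Parities, through which both `ζ` and `χ` are expressed.

select : ∀ {ℓ} {A : Set ℓ} → A → A → Parity → A
select x y 0ℙ = x
select x y 1ℙ = y

toℕ : Parity → ℕ
toℕ = select 0 1

parity-suc : ∀ n → parity (suc n) ≡ parity n ℙ.⁻¹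
parity-suc = ℙ.+-homo-+ 1

ζ-parity : ∀ n → ζ n ≡ toℕ (parity n)
ζ-parity n with parity n
... | 0ℙ = ≡.refl
... | 1ℙ = ≡.refl

ζ-parity-suc : ∀ n → ζ (n ℕ.+ 1) ≡ toℕ (parity n ℙ.⁻¹)
ζ-parity-suc n =
  ≡.trans (ζ-parity (n ℕ.+ 1)) (≡.cong toℕ (≡.trans (≡.cong parity (ℕ.+-comm n 1)) (parity-suc n)))

module Recurrence {ℓ₁ ℓ₂} (R : CommutativeRing ℓ₁ ℓ₂) where

  open CommutativeRing R
  open Exp semiring using (_^_)
  open RingProperties ring using (-‿distribˡ-*; -‿distribʳ-*; -‿+-comm; x[y-z]≈xy-xz; ⁻¹-anti-homo‿-)
  open SemiringSolver commutativeSemiring using (solve; _:+_; _:*_; _:=_; con)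
  open SetoidReasoning setoid

  -- Second-order linear recurrences with variable coefficients.

  Recurrent : (ℕ → Carrier) → Carrier → (ℕ → Carrier) → Set ℓ₂
  Recurrent κ c x = ∀ q → x (2 ℕ.+ q) ≈ κ q * x (1 ℕ.+ q) + c * x q

  -- `parity n` serves as the parity of the index `2 + n` of the new term: the two agree by
  -- computation.
  BiPeriodic : Carrier → Carrier → Carrier → (ℕ → Carrier) → Set ℓ₂
  BiPeriodic a b = Recurrent (λ n → select a b (parity n))

  recurrent-unique : ∀ {κ c x y} → Recurrent κ c x → Recurrent κ c y →
                     x 0 ≈ y 0 → x 1 ≈ y 1 → ∀ q → x q ≈ y q
  recurrent-unique rx ry x₀≈y₀ x₁≈y₁ 0 = x₀≈y₀
  recurrent-unique rx ry x₀≈y₀ x₁≈y₁ 1 = x₁≈y₁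
  recurrent-unique {κ} {c} {x} {y} rx ry x₀≈y₀ x₁≈y₁ (suc (suc q)) = begin
    x (2 ℕ.+ q)                  ≈⟨ rx q ⟩
    κ q * x (1 ℕ.+ q) + c * x q  ≈⟨ +-cong (*-congˡ (x≈y (suc q))) (*-congˡ (x≈y q)) ⟩
    κ q * y (1 ℕ.+ q) + c * y q  ≈⟨ ry q ⟨
    y (2 ℕ.+ q)                  ∎
    where
    x≈y : ∀ q → x q ≈ y q
    x≈y = recurrent-unique rx ry x₀≈y₀ x₁≈y₁

  -- Period two of `f` leaves the term with `c` intact; in the other term, `f q * η q` is exchanged
  -- for `κ q * f (1 + q)`. A weight can thus repair a mismatch of coefficients.
  recurrent-weighted : ∀ {η κ c} {f x : ℕ → Carrier} t → Recurrent η c x → (∀ q → f (2 ℕ.+ q) ≡ f q) →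
                       (∀ q → f q * η q ≈ κ q * f (1 ℕ.+ q)) →
                       Recurrent κ c (λ q → f q * t * x q)
  recurrent-weighted {η} {κ} {c} {f} {x} t rx f-periodic f-step q = begin
    f (2 ℕ.+ q) * t * x (2 ℕ.+ q)
      ≈⟨ *-cong (*-congʳ (reflexive (f-periodic q))) (rx q) ⟩
    f q * t * (η q * x (1 ℕ.+ q) + c * x q)
      ≈⟨ solve 6 (λ f t η y c z → f :* t :* (η :* y :+ c :* z) := f :* η :* (t :* y) :+ c :* (f :* t :* z))
           refl (f q) t (η q) (x (1 ℕ.+ q)) c (x q) ⟩
    f q * η q * (t * x (1 ℕ.+ q)) + c * (f q * t * x q)
      ≈⟨ +-congʳ (*-congʳ (f-step q)) ⟩
    κ q * f (1 ℕ.+ q) * (t * x (1 ℕ.+ q)) + c * (f q * t * x q)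
      ≈⟨ +-congʳ (solve 4 (λ k f t y → k :* f :* (t :* y) := k :* (f :* t :* y))
           refl (κ q) (f (1 ℕ.+ q)) t (x (1 ℕ.+ q))) ⟩
    κ q * (f (1 ℕ.+ q) * t * x (1 ℕ.+ q)) + c * (f q * t * x q) ∎

  recurrent-difference : ∀ {κ c x y} → Recurrent κ c x → Recurrent κ c y →
                         Recurrent κ c (λ q → x q - y q)
  recurrent-difference {κ} {c} {x} {y} rx ry q = begin
    x (2 ℕ.+ q) - y (2 ℕ.+ q)
      ≈⟨ +-cong (rx q) (-‿cong (ry q)) ⟩
    (κ q * x (1 ℕ.+ q) + c * x q) - (κ q * y (1 ℕ.+ q) + c * y q)
      ≈⟨ +-congˡ (-‿+-comm _ _) ⟨
    (κ q * x (1 ℕ.+ q) + c * x q) + (- (κ q * y (1 ℕ.+ q)) - c * y q)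
      ≈⟨ +-congˡ (+-cong (-‿distribʳ-* _ _) (-‿distribʳ-* _ _)) ⟩
    (κ q * x (1 ℕ.+ q) + c * x q) + (κ q * - y (1 ℕ.+ q) + c * - y q)
      ≈⟨ solve 6 (λ k x y c x′ y′ → (k :* x :+ c :* x′) :+ (k :* y :+ c :* y′) := k :* (x :+ y) :+ c :* (x′ :+ y′))
           refl (κ q) (x (1 ℕ.+ q)) (- y (1 ℕ.+ q)) c (x q) (- y q) ⟩
    κ q * (x (1 ℕ.+ q) - y (1 ℕ.+ q)) + c * (x q - y q) ∎

  x+y-[x+z]≈y-z : ∀ x y z → (x + y) - (x + z) ≈ y - z
  x+y-[x+z]≈y-z x y z = begin
    (x + y) - (x + z)        ≈⟨ +-congˡ (-‿+-comm x z) ⟨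
    (x + y) + (- x - z)      ≈⟨ solve 4 (λ x y x̄ z̄ → (x :+ y) :+ (x̄ :+ z̄) := (x :+ x̄) :+ (y :+ z̄)) refl x y (- x) (- z) ⟩
    (x - x) + (y - z)        ≈⟨ +-congʳ (-‿inverseʳ x) ⟩
    0# + (y - z)             ≈⟨ +-identityˡ (y - z) ⟩
    y - z                    ∎

  inverse-cancelʳ : ∀ x x⁻¹ y → x * x⁻¹ ≈ 1# → y * x⁻¹ * x ≈ y
  inverse-cancelʳ x x⁻¹ y xx⁻¹≈1 = begin
    y * x⁻¹ * x    ≈⟨ solve 3 (λ x z y → y :* z :* x := y :* (x :* z)) refl x x⁻¹ y ⟩
    y * (x * x⁻¹)  ≈⟨ *-congˡ xx⁻¹≈1 ⟩
    y * 1#         ≈⟨ *-identityʳ y ⟩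
    y              ∎

  -- Powers of `r`, the abstract `b / a`, and the coefficients they exchange.

  module _ (a b c r : Carrier) (ra≈b : r * a ≈ b) where

    private
      coefficient : Parity → Carrier
      coefficient = select a b

    weight : Parity → Parity → Parity → Carrier
    weight i j k = r ^ (toℕ i ℕ.* toℕ j ℕ.* toℕ k)

    weight-comm : ∀ i j k → weight i j k ≡ weight i k j
    weight-comm 0ℙ j  k  = ≡.refl
    weight-comm 1ℙ 0ℙ 0ℙ = ≡.refl
    weight-comm 1ℙ 0ℙ 1ℙ = ≡.refl
    weight-comm 1ℙ 1ℙ 0ℙ = ≡.refl
    weight-comm 1ℙ 1ℙ 1ℙ = ≡.refl

    weight-0ℙ : ∀ i j → weight i j 0ℙ ≡ 1#
    weight-0ℙ i j = ≡.cong (r ^_) (ℕ.*-zeroʳ (toℕ i ℕ.* toℕ j))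

    private
      one : ∀ x → 1# * x ≈ x * 1#
      one = *-comm 1#

      -- The two uses of `r a = b`: `up` spends a factor `r` to turn `a` into `b`, and `down` turns
      -- `b` into `a` and leaves a factor `r`.
      up : r ^ 1 * a ≈ b * 1#
      up = trans (solve 2 (λ r a → (r :* con 1) :* a := (r :* a) :* con 1) refl r a) (*-congʳ ra≈b)

      down : 1# * b ≈ a * r ^ 1
      down = trans (one b) (trans (sym up) (*-comm (r ^ 1) a))

    -- The parity `k` is flipped exactly when `i` is odd and `j` even. The next three lemmas bring
    -- different sequences in `q` to these common coefficients.
    shifted-coefficient : Parity → Parity → Parity → Carrier
    shifted-coefficient i j k = coefficient (i ℙ.* j ℙ.⁻¹ ℙ.+ k)

    -- For the factor `w (n + q)` of the first product. The coefficients differ only for `i` and `j`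
    -- odd, where the weight alternates between 1 and `r`.
    weight-step₁ : ∀ i j k →
      weight i j k * coefficient (i ℙ.+ k) ≈ shifted-coefficient i j k * weight i j (k ℙ.⁻¹)
    weight-step₁ 0ℙ j  k  = one (coefficient k)
    weight-step₁ 1ℙ 0ℙ k  = one (coefficient (1ℙ ℙ.+ k))
    weight-step₁ 1ℙ 1ℙ 0ℙ = down
    weight-step₁ 1ℙ 1ℙ 1ℙ = up

    -- For the factor `w (n + p + q)` of the second product; here the mismatch occurs for `i` even
    -- and `j` odd.
    weight-step₂ : ∀ i j k →
      weight (i ℙ.⁻¹) j k * coefficient (i ℙ.+ j ℙ.+ k) ≈ shifted-coefficient i j k * weight (i ℙ.⁻¹) j (k ℙ.⁻¹)
    weight-step₂ 1ℙ j  k  = one (coefficient (j ℙ.⁻¹ ℙ.+ k))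
    weight-step₂ 0ℙ 0ℙ k  = one (coefficient k)
    weight-step₂ 0ℙ 1ℙ 0ℙ = down
    weight-step₂ 0ℙ 1ℙ 1ℙ = up

    -- For `u q`, which is not shifted; here the mismatch occurs for `i` odd and `j` even.
    weight-step₃ : ∀ i j k →
      weight i (j ℙ.⁻¹) (k ℙ.⁻¹) * coefficient k ≈ shifted-coefficient i j k * weight i (j ℙ.⁻¹) (k ℙ.⁻¹ ℙ.⁻¹)
    weight-step₃ 0ℙ j  k  = one (coefficient k)
    weight-step₃ 1ℙ 1ℙ k  = one (coefficient k)
    weight-step₃ 1ℙ 0ℙ 0ℙ = up
    weight-step₃ 1ℙ 0ℙ 1ℙ = down

    -- Makes the mixed terms equal, and so cancel, in the Cassini step.
    weight-step₄ : ∀ i →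
      weight (i ℙ.⁻¹) 1ℙ 1ℙ * coefficient i ≈ coefficient (i ℙ.⁻¹) * weight i 1ℙ 1ℙ
    weight-step₄ 0ℙ = up
    weight-step₄ 1ℙ = down

    -- The parity of `m` is a separate argument so that, for `m = n + p`, it can be given as the sum
    -- of the two parities.
    biPeriodic-shift : ∀ {x} → BiPeriodic a b c x → ∀ m {i} → parity m ≡ i →
                       Recurrent (λ q → coefficient (i ℙ.+ parity q)) c (λ q → x (m ℕ.+ q))
    biPeriodic-shift {x} rx m ≡.refl q
      rewrite ℕ.+-suc m (suc q) | ℕ.+-suc m q | ≡.sym (ℙ.+-homo-+ m q) = rx (m ℕ.+ q)

    module _ {u : ℕ → Carrier} (u-rec : BiPeriodic a b c u) (u₀≈0 : u 0 ≈ 0#) (u₁≈1 : u 1 ≈ 1#)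
             {w : ℕ → Carrier} (w-rec : BiPeriodic a b c w) where

      -- The difference D(n, p, q) and its reduction to p = q = 1.

      defect : ℕ → ℕ → ℕ → Carrier
      defect n p q = weight (parity n) (parity p) (parity q) * w (n ℕ.+ p) * w (n ℕ.+ q)
                   - weight (parity n ℙ.⁻¹) (parity p) (parity q) * w n * w (n ℕ.+ p ℕ.+ q)

      defect-recurrent : ∀ n p →
        Recurrent (λ q → shifted-coefficient (parity n) (parity p) (parity q)) c (defect n p)
      defect-recurrent n p = recurrent-difference
        -- In each product the factor free of `q` is the constant `t`, and the other is a shift of
        -- `w`.
        (recurrent-weighted (w (n ℕ.+ p)) (biPeriodic-shift w-rec n ≡.refl) (λ _ → ≡.refl)
          λ q → trans (weight-step₁ i j (parity q)) (*-congˡ (next i q)))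
        (recurrent-weighted (w n) (biPeriodic-shift w-rec (n ℕ.+ p) (ℙ.+-homo-+ n p)) (λ _ → ≡.refl)
          λ q → trans (weight-step₂ i j (parity q)) (*-congˡ (next (i ℙ.⁻¹) q)))
        where
        i j : Parity
        i = parity n
        j = parity p
        next : ∀ i q → weight i j (parity q ℙ.⁻¹) ≈ weight i j (parity (suc q))
        next i q = reflexive (≡.cong (weight i j) (≡.sym (parity-suc q)))

      defect-0 : ∀ n p → defect n p 0 ≈ 0#
      defect-0 n p = begin
        defect n p 0
          ≈⟨ +-cong (*-congʳ (*-congʳ (reflexive (weight-0ℙ i j)))) (-‿cong (*-congʳ (*-congʳ (reflexive (weight-0ℙ (i ℙ.⁻¹) j))))) ⟩
        1# * w (n ℕ.+ p) * w (n ℕ.+ 0) - 1# * w n * w (n ℕ.+ p ℕ.+ 0)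
          ≡⟨ ≡.cong₂ (λ k l → 1# * w (n ℕ.+ p) * w k - 1# * w n * w l) (ℕ.+-identityʳ n) (ℕ.+-identityʳ (n ℕ.+ p)) ⟩
        1# * w (n ℕ.+ p) * w n - 1# * w n * w (n ℕ.+ p)
          ≈⟨ +-congʳ (solve 3 (λ e x y → e :* x :* y := e :* y :* x) refl 1# (w (n ℕ.+ p)) (w n)) ⟩
        1# * w n * w (n ℕ.+ p) - 1# * w n * w (n ℕ.+ p)
          ≈⟨ -‿inverseʳ _ ⟩
        0# ∎
        where
        i j : Parity
        i = parity n
        j = parity p

      -- Lets the expansion in the last argument be applied to `p` as well.
      defect-comm : ∀ n p q → defect n p q ≈ defect n q p
      defect-comm n p q = +-cong
        (begin
          weight i j k * w (n ℕ.+ p) * w (n ℕ.+ q)  ≡⟨ ≡.cong (λ t → t * w (n ℕ.+ p) * w (n ℕ.+ q)) (weight-comm i j k) ⟩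
          weight i k j * w (n ℕ.+ p) * w (n ℕ.+ q)  ≈⟨ solve 3 (λ e x y → e :* x :* y := e :* y :* x) refl _ _ _ ⟩
          weight i k j * w (n ℕ.+ q) * w (n ℕ.+ p)  ∎)
        (-‿cong (reflexive (≡.cong₂ (λ t m → t * w n * w m) (weight-comm (i ℙ.⁻¹) j k) n+p+q≡n+q+p)))
        where
        i j k : Parity
        i = parity n
        j = parity p
        k = parity q
        n+p+q≡n+q+p : n ℕ.+ p ℕ.+ q ≡ n ℕ.+ q ℕ.+ p
        n+p+q≡n+q+p = ≡.trans (ℕ.+-assoc n p q) (≡.trans (≡.cong (n ℕ.+_) (ℕ.+-comm p q)) (≡.sym (ℕ.+-assoc n q p)))

      -- Both sides obey the same recurrence in `q`. They vanish at 0, and at 1 the weight on the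
      -- right is `r ^ 0` and `u 1` is 1.
      defect-expand : ∀ n p q →
        defect n p q ≈ weight (parity n) (parity p ℙ.⁻¹) (parity q ℙ.⁻¹) * defect n p 1 * u q
      defect-expand n p = recurrent-unique (defect-recurrent n p)
        (recurrent-weighted {f = λ q → weight i (j ℙ.⁻¹) (parity q ℙ.⁻¹)} (defect n p 1) u-rec (λ _ → ≡.refl)
          λ q → trans (weight-step₃ i j (parity q))
            (*-congˡ (reflexive (≡.cong (λ k → weight i (j ℙ.⁻¹) (k ℙ.⁻¹)) (≡.sym (parity-suc q))))))
        (begin
          defect n p 0                                ≈⟨ defect-0 n p ⟩
          0#                                          ≈⟨ zeroʳ _ ⟨
          weight i (j ℙ.⁻¹) 1ℙ * defect n p 1 * 0#    ≈⟨ *-congˡ u₀≈0 ⟨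
          weight i (j ℙ.⁻¹) 1ℙ * defect n p 1 * u 0   ∎)
        (begin
          defect n p 1                                ≈⟨ *-identityˡ _ ⟨
          1# * defect n p 1                           ≈⟨ *-identityʳ _ ⟨
          1# * defect n p 1 * 1#                      ≈⟨ *-cong (*-congʳ (reflexive (weight-0ℙ i (j ℙ.⁻¹)))) u₁≈1 ⟨
          weight i (j ℙ.⁻¹) 0ℙ * defect n p 1 * u 1   ∎)
        where
        i j : Parity
        i = parity n
        j = parity p

      -- After the swap the middle argument is 1. Its flipped parity is even, so the weight of the
      -- expansion is trivial.
      defect-1 : ∀ n p → defect n p 1 ≈ defect n 1 1 * u p
      defect-1 n p = begin
        defect n p 1                                            ≈⟨ defect-comm n p 1 ⟩
        defect n 1 p                                            ≈⟨ defect-expand n 1 p ⟩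
        weight i 0ℙ (j ℙ.⁻¹) * defect n 1 1 * u p               ≡⟨ ≡.cong (λ t → t * defect n 1 1 * u p) (≡.trans (weight-comm i 0ℙ (j ℙ.⁻¹)) (weight-0ℙ i (j ℙ.⁻¹))) ⟩
        1# * defect n 1 1 * u p                                 ≈⟨ *-congʳ (*-identityˡ _) ⟩
        defect n 1 1 * u p                                      ∎
        where
        i j : Parity
        i = parity n
        j = parity p

      -- A Cassini identity for `w`.

      cassini : ℕ → Carrier
      cassini n = weight (parity n) 1ℙ 1ℙ * w (1 ℕ.+ n) * w (1 ℕ.+ n)
                - weight (parity n ℙ.⁻¹) 1ℙ 1ℙ * w n * w (2 ℕ.+ n)

      defect-1-1 : ∀ n → defect n 1 1 ≡ cassini n
      -- The first rewriting turns `n + 1 + 1` into `suc n + 1`, which exposes another `n + 1` for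
      -- the second.
      defect-1-1 n rewrite ℕ.+-comm n 1 | ℕ.+-comm n 1 = ≡.refl

      -- Expanding one `w₂` of the square and the factor `w₃` produces the same mixed term in
      -- `w₁ * w₂`. What remains is `c` times the previous value with its two products interchanged,
      -- hence the sign.
      cassini-suc : ∀ n → cassini (suc n) ≈ - c * cassini n
      cassini-suc n = begin
        cassini (suc n)
          ≡⟨ ≡.cong₂ (λ i j → weight i 1ℙ 1ℙ * w₂ * w₂ - weight j 1ℙ 1ℙ * w₁ * w₃) (parity-suc n) (ℙ.suc-homo-⁻¹ n) ⟩
        t * w₂ * w₂ - s * w₁ * w₃
          ≈⟨ +-cong expand₂ (-‿cong expand₃) ⟩
        (g * s * (w₁ * w₂) + c * (t * w₀ * w₂)) - (g * s * (w₁ * w₂) + c * (s * w₁ * w₁))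
          ≈⟨ x+y-[x+z]≈y-z _ _ _ ⟩
        c * (t * w₀ * w₂) - c * (s * w₁ * w₁)
          ≈⟨ x[y-z]≈xy-xz c _ _ ⟨
        c * (t * w₀ * w₂ - s * w₁ * w₁)
          ≈⟨ *-congˡ (⁻¹-anti-homo‿- _ _) ⟨
        c * - cassini n
          ≈⟨ -‿distribʳ-* c _ ⟨
        - (c * cassini n)
          ≈⟨ -‿distribˡ-* c _ ⟩
        - c * cassini n ∎
        where
        i : Parity
        i = parity n
        s t g h w₀ w₁ w₂ w₃ : Carrier
        s = weight i 1ℙ 1ℙ
        t = weight (i ℙ.⁻¹) 1ℙ 1ℙ
        g = coefficient (i ℙ.⁻¹)
        h = coefficient i
        w₀ = w n
        w₁ = w (1 ℕ.+ n)
        w₂ = w (2 ℕ.+ n)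
        w₃ = w (3 ℕ.+ n)
        expand₂ : t * w₂ * w₂ ≈ g * s * (w₁ * w₂) + c * (t * w₀ * w₂)
        expand₂ = begin
          t * w₂ * w₂
            ≈⟨ *-congʳ (*-congˡ (w-rec n)) ⟩
          t * (h * w₁ + c * w₀) * w₂
            ≈⟨ solve 6 (λ t h x c y z → t :* (h :* x :+ c :* y) :* z := t :* h :* (x :* z) :+ c :* (t :* y :* z))
                 refl t h w₁ c w₀ w₂ ⟩
          t * h * (w₁ * w₂) + c * (t * w₀ * w₂)
            ≈⟨ +-congʳ (*-congʳ (weight-step₄ i)) ⟩
          g * s * (w₁ * w₂) + c * (t * w₀ * w₂) ∎
        expand₃ : s * w₁ * w₃ ≈ g * s * (w₁ * w₂) + c * (s * w₁ * w₁)
        expand₃ = begin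
          s * w₁ * w₃
            ≈⟨ *-congˡ (w-rec (suc n)) ⟩
          s * w₁ * (coefficient (parity (suc n)) * w₂ + c * w₁)
            ≡⟨ ≡.cong (λ i → s * w₁ * (coefficient i * w₂ + c * w₁)) (parity-suc n) ⟩
          s * w₁ * (g * w₂ + c * w₁)
            ≈⟨ solve 5 (λ s x g y c → s :* x :* (g :* y :+ c :* x) := g :* s :* (x :* y) :+ c :* (s :* x :* x))
                 refl s w₁ g w₂ c ⟩
          g * s * (w₁ * w₂) + c * (s * w₁ * w₁) ∎

      -- The weights are 1 and `r`; expanding `w 2` gives `r * a * w 0 * w 1`, whose `r * a` is `b`.
      cassini-0 : cassini 0 ≈ w 1 ^ 2 - b * w 0 * w 1 - r * c * w 0 ^ 2
      cassini-0 = begin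
        1# * w 1 * w 1 - r ^ 1 * w 0 * w 2
          ≈⟨ +-cong (solve 1 (λ x → con 1 :* x :* x := x :* (x :* con 1)) refl (w 1)) (-‿cong expand) ⟩
        w 1 ^ 2 - (b * w 0 * w 1 + r * c * w 0 ^ 2)
          ≈⟨ +-congˡ (-‿+-comm _ _) ⟨
        w 1 ^ 2 + (- (b * w 0 * w 1) - r * c * w 0 ^ 2)
          ≈⟨ +-assoc _ _ _ ⟨
        w 1 ^ 2 - b * w 0 * w 1 - r * c * w 0 ^ 2 ∎
        where
        expand : r ^ 1 * w 0 * w 2 ≈ b * w 0 * w 1 + r * c * w 0 ^ 2
        expand = begin
          r ^ 1 * w 0 * w 2
            ≈⟨ *-congˡ (w-rec 0) ⟩
          r ^ 1 * w 0 * (a * w 1 + c * w 0)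
            ≈⟨ solve 5 (λ r x a y c → (r :* con 1) :* x :* (a :* y :+ c :* x) :=
                   r :* a :* x :* y :+ r :* c :* (x :* (x :* con 1))) refl r (w 0) a (w 1) c ⟩
          r * a * w 0 * w 1 + r * c * w 0 ^ 2
            ≈⟨ +-congʳ (*-congʳ (*-congʳ ra≈b)) ⟩
          b * w 0 * w 1 + r * c * w 0 ^ 2 ∎

      cassini-closed : ∀ n → cassini n ≈ (- c) ^ n * (w 1 ^ 2 - b * w 0 * w 1 - r * c * w 0 ^ 2)
      cassini-closed 0       = trans cassini-0 (sym (*-identityˡ _))
      cassini-closed (suc n) = trans (cassini-suc n) (trans (*-congˡ (cassini-closed n)) (sym (*-assoc _ _ _)))

      -- The closed form of D, and its exponents in terms of `ζ`.

      defect-closed : ∀ n p q →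
        defect n p q ≈ weight (parity n) (parity p ℙ.⁻¹) (parity q ℙ.⁻¹) * (- c) ^ n * u p * u q
                       * (w 1 ^ 2 - b * w 0 * w 1 - r * c * w 0 ^ 2)
      defect-closed n p q = begin
        defect n p q                                ≈⟨ defect-expand n p q ⟩
        ρ * defect n p 1 * u q                      ≈⟨ *-congʳ (*-congˡ (defect-1 n p)) ⟩
        ρ * (defect n 1 1 * u p) * u q              ≡⟨ ≡.cong (λ d → ρ * (d * u p) * u q) (defect-1-1 n) ⟩
        ρ * (cassini n * u p) * u q                 ≈⟨ *-congʳ (*-congˡ (*-congʳ (cassini-closed n))) ⟩
        ρ * ((- c) ^ n * k * u p) * u q             ≈⟨ solve 5 (λ ρ e k x y → ρ :* (e :* k :* x) :* y := ρ :* e :* x :* y :* k) refl ρ ((- c) ^ n) k (u p) (u q) ⟩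
        ρ * (- c) ^ n * u p * u q * k               ∎
        where
        ρ k : Carrier
        ρ = weight (parity n) (parity p ℙ.⁻¹) (parity q ℙ.⁻¹)
        k = w 1 ^ 2 - b * w 0 * w 1 - r * c * w 0 ^ 2

      defect-ζ : ∀ n p q →
        r ^ (ζ n ℕ.* ζ p ℕ.* ζ q) * w (n ℕ.+ p) * w (n ℕ.+ q)
          - r ^ (ζ (n ℕ.+ 1) ℕ.* ζ p ℕ.* ζ q) * w n * w (n ℕ.+ p ℕ.+ q)
        ≈ r ^ (ζ n ℕ.* ζ (p ℕ.+ 1) ℕ.* ζ (q ℕ.+ 1)) * (- c) ^ n * u p * u q
          * (w 1 ^ 2 - b * w 0 * w 1 - r * c * w 0 ^ 2)
      defect-ζ n p q
        rewrite ζ-parity-suc n | ζ-parity-suc p | ζ-parity-suc q | ζ-parity n | ζ-parity p | ζ-parity q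
        = defect-closed n p q

open import Defs

open Recurrence ℝ-commutativeRing

-- Below, mk≈ (seq~ …) restates a result about the operations of
-- ℝ-commutativeRing for those of Defs: they agree only after unfolding, and
-- comparing reals rather than sequences would unfold the Cauchy proofs too.

/-cancelʳ : ∀ a b {{a#0 : a # 0ℝ}} → b / a * a ≈ b
/-cancelʳ a b = mk≈ (seq~ (inverse-cancelʳ a (a ⁻¹) b (mk≈ (seq~ (*-inverseʳ a)))))

χ-parity : ∀ a b n → χ a b n ≡ select a b (parity n)
χ-parity a b n with parity n
... | 0ℙ = ≡.refl
... | 1ℙ = ≡.refl

horadam-biPeriodic : ∀ a b c w₀ w₁ → BiPeriodic a b c (horadam a b c w₀ w₁)
horadam-biPeriodic a b c w₀ w₁ n = mk≈ (≡.subst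
  (λ k → seq (w (2 ℕ.+ n)) ~ seq (k * w (1 ℕ.+ n) + c * w n))
  -- With `χ` as coefficient the recurrence holds by definition, so `cauchy`, which is reflexivity
  -- of `~`, proves it; only the coefficient is transported.
  (χ-parity a b (2 ℕ.+ n)) (cauchy (w (2 ℕ.+ n))))
  where
  w : ℕ → ℝ
  w = horadam a b c w₀ w₁

horadam-identity : ∀ {a b c r} → r * a ≈ b →
  {u : ℕ → ℝ} → BiPeriodic a b c u → u 0 ≈ 0ℝ → u 1 ≈ 1ℝ →
  {w : ℕ → ℝ} → BiPeriodic a b c w → ∀ n p q →
    r ^ (ζ n ℕ.* ζ p ℕ.* ζ q) * w (n ℕ.+ p) * w (n ℕ.+ q)
      - r ^ (ζ (n ℕ.+ 1) ℕ.* ζ p ℕ.* ζ q) * w n * w (n ℕ.+ p ℕ.+ q)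
    ≈ r ^ (ζ n ℕ.* ζ (p ℕ.+ 1) ℕ.* ζ (q ℕ.+ 1)) * (- c) ^ n * u p * u q
      * (w 1 ^ 2 - b * w 0 * w 1 - r * c * w 0 ^ 2)
horadam-identity {a} {b} {c} {r} ra≈b {u} u-rec u₀≈0 u₁≈1 {w} w-rec n p q =
  mk≈ (seq~ (defect-ζ a b c r (mk≈ (seq~ ra≈b)) {u} u-rec u₀≈0 u₁≈1 {w} w-rec n p q))

fibonacci-biPeriodic : ∀ a b c → BiPeriodic a b c (fibonacci a b c)
fibonacci-biPeriodic a b c n = mk≈ (seq~ (horadam-biPeriodic a b c 0ℝ 1ℝ n))

theorem4 :
    (a b c w₀ w₁ : ℝ) {{a#0 : a # 0ℝ}} {{b#0 : b # 0ℝ}} {{c#0 : c # 0ℝ}} →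
    let w = horadam a b c w₀ w₁
        u = fibonacci a b c
    in
    (n p q : ℕ) .{{_ : NonZero n}} .{{_ : NonZero p}} .{{_ : NonZero q}} →
      (b / a) ^ (ζ n ℕ.* ζ p ℕ.* ζ q) * w (n ℕ.+ p) * w (n ℕ.+ q)
        - (b / a) ^ (ζ (n ℕ.+ 1) ℕ.* ζ p ℕ.* ζ q) * w n * w (n ℕ.+ p ℕ.+ q)
      ≈ (b / a) ^ (ζ n ℕ.* ζ (p ℕ.+ 1) ℕ.* ζ (q ℕ.+ 1)) * (- c) ^ n * u p * u q
        * (w₁ ^ 2 - b * w₀ * w₁ - (b / a) * c * w₀ ^ 2)
theorem4 a b c w₀ w₁ {{a#0}} n p q = mk≈ (seq~ (horadam-identity {a} {b} {c} {_/_ b a {{a#0}}} (/-cancelʳ a b {{a#0}})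
  -- The initial values of `fibonacci` are 0 and 1 by definition, hence constant sequences.
  {fibonacci a b c} (fibonacci-biPeriodic a b c) (mk≈ (~-const _)) (mk≈ (~-const _))
  {horadam a b c w₀ w₁} (horadam-biPeriodic a b c w₀ w₁) n p q))
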